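{- For all sufficiently large $n$, $\hat{r}(P_n) < 137n$.
   Context: $P_n$ denotes the path on $n$ vertices. For finite graphs $F$ and $G$, write $G \to F$ if every colouring of the edges of $G$ with two colours yields a monochromatic copy of $F$. The size-Ramsey number of $F$ is $\hat{r}(F) = \min\{|E(G)| : G \to F\}$. -}

module Defs where

open import Data.Nat using (ℕ; suc; _<_; _≤_)
open import Data.Nat.Properties using (_<?_)
open import Data.Fin using (Fin; toℕ)
open import Data.Fin.Properties using () renaming (_≟_ to _≟ᶠ_)
open import Data.Bool using (Bool)
open import Data.List using (List; length; filter; allFin; cartesianProduct)
open import Data.Product using (Σ; ∃; _×_; _,_; proj₁; proj₂)
open import Data.Sum using (_⊎_)
open import Relation.Nullary using (¬_; Dec)
open import Relation.Nullary.Decidable using (_×-dec_; _⊎-dec_)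
open import Relation.Binary.PropositionalEquality using (_≡_)
open import Function.Definitions using (Injective)
open import Level using (0ℓ)

record Graph : Set₁ where
  field
    V     : ℕ
    Adj   : Fin V → Fin V → Set
    adj?  : (i j : Fin V) → Dec (Adj i j)
    sym   : ∀ {i j} → Adj i j → Adj j i
    irrefl : ∀ {i} → ¬ Adj i i
open Graph public

numEdges : Graph → ℕ
numEdges G = length (filter (λ p → (toℕ (proj₁ p) <? toℕ (proj₂ p)) ×-dec adj? G (proj₁ p) (proj₂ p))
                            (cartesianProduct (allFin (V G)) (allFin (V G))))

-- A 2-colouring of the edges of G (given as a symmetric function on vertex
-- pairs; only its values on edges matter).
record Colouring (G : Graph) : Set where
  field
    col    : Fin (V G) → Fin (V G) → Bool
    col-sym : ∀ i j → col i j ≡ col j i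
open Colouring public

MonoCopy : (F G : Graph) → Colouring G → Bool → Set
MonoCopy F G c b =
  Σ (Fin (V F) → Fin (V G)) λ φ →
    Injective _≡_ _≡_ φ ×
    (∀ i j → Adj F i j → Adj G (φ i) (φ j) × col c (φ i) (φ j) ≡ b)

_⟶_ : Graph → Graph → Set
G ⟶ F = (c : Colouring G) → Σ Bool λ b → MonoCopy F G c b

IsSizeRamsey : Graph → ℕ → Set₁
IsSizeRamsey F r =
  (Σ Graph λ G → (G ⟶ F) × numEdges G ≡ r) ×
  ((G : Graph) → G ⟶ F → r ≤ numEdges G)

PathAdj : (n : ℕ) → Fin n → Fin n → Set
PathAdj n i j = (toℕ j ≡ suc (toℕ i)) ⊎ (toℕ i ≡ suc (toℕ j))

P : ℕ → Graph
P n = record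
  { V = n
  ; Adj = PathAdj n
  ; adj? = λ i j → (toℕ j Data.Nat.≟ suc (toℕ i)) ⊎-dec (toℕ i Data.Nat.≟ suc (toℕ j))
  ; sym = λ { (Data.Sum.inj₁ e) → Data.Sum.inj₂ e ; (Data.Sum.inj₂ e) → Data.Sum.inj₁ e }
  ; irrefl = irr
  }
  where
  open import Data.Nat.Properties using (1+n≢n)
  open import Relation.Binary.PropositionalEquality renaming (sym to ≡sym) using ()
  irr : ∀ {i} → ¬ PathAdj n i i
  irr {i} (Data.Sum.inj₁ e) = 1+n≢n (≡sym e)
  irr {i} (Data.Sum.inj₂ e) = 1+n≢n (≡sym e)

{-# OPTIONS --safe #-}

-- Call a graph connecting if any two disjoint n-sets of vertices are joined by
-- an edge. A connecting graph on 6n vertices arrows P_n: depth-first search in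
-- the blue graph, stopped when k = 2n + ⌊n/2⌋ vertices are finished, yields a
-- blue P_n or sets U, D of at least k vertices with no blue edge in between.
-- Depth-first search in the red bipartite graph between U and D, stopped when n
-- vertices on one side are finished, then yields a red P_n or n finished
-- vertices on one side and n unexplored ones on the other, with no edge at all
-- in between; here it matters that a red path alternates, so that fewer than n
-- path vertices use up at most n/2 of each side.
--
-- Connecting graphs with 136n edges exist: each of the at most 3^(6n) pairs
-- (S, T) of disjoint sets of size at least n is joined by at least 2n² of the
-- 36n² ordered pairs of vertices, so some pair of vertices joins at least 1/18
-- of the (S, T) not joined yet. Choosing such pairs greedily 136n times leaves
-- fewer than 3^(6n) (17/18)^(136n) < 1 of them.
--
-- The minimum in the definition of the size-Ramsey number is found by a finite
-- search, because a graph without isolated vertices has at most twice as many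
-- vertices as edges.
module Submission where

open import Defs
open import Data.Nat using (ℕ; _≤_; _<_; _*_)
open import Data.Product using (Σ; _×_)
open import Data.Bool using (Bool; true; false; _∨_)
import Data.Bool.Properties as Bool
open import Data.Empty using (⊥)
open import Data.Fin using (Fin; zero; suc; toℕ; inject≤; inject₁; fromℕ<)
open import Data.Fin.Patterns using (0F; 1F; 2F)
import Data.Fin.Properties as Fin
open import Data.Fin.Properties using (toℕ-inject≤; inject≤-injective; toℕ-injective) renaming (_≟_ to _≟ᶠ_)
open import Data.List using (List; []; _∷_; _++_; length; filter; allFin; lookup; map; cartesianProduct; cartesianProductWith)
open import Data.List.Extrema.Nat using (argmax; f[xs]≤f[argmax])
open import Data.List.Properties using (length-++; length-filter; length-map; length-tabulate; filter-all; filter-++; ++-identityʳ)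
open import Data.List.Membership.Propositional using (_∈_; find; lose)
open import Data.List.Membership.Propositional.Properties using (∈-∃++; ∈-lookup; ∈-++⁻; ∈-++⁺ˡ; ∈-++⁺ʳ; ∈-filter⁺; ∈-filter⁻; ∈-map⁺; ∈-allFin; ∈-cartesianProduct⁺; ∈-cartesianProduct⁻; ∈-cartesianProductWith⁺)
import Data.List.Membership.DecPropositional as DecMembership
open import Data.List.Relation.Binary.Disjoint.Propositional using (Disjoint)
open import Data.List.Relation.Binary.Permutation.Propositional using (_↭_; ↭-sym; ↭-trans; ↭-reflexive; ↭⇒↭ₛ)
open import Data.List.Relation.Binary.Permutation.Propositional.Properties using (shift; ∈-resp-↭; ↭-length; ++⁺ʳ; ++⁺ˡ; filter-↭)
import Data.List.Relation.Binary.Permutation.Setoid.Properties as Permₛ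
open import Data.List.Relation.Binary.Subset.Propositional using (_⊆_)
open import Data.List.Relation.Unary.All as All using (All; []; _∷_)
import Data.List.Relation.Unary.All.Properties as All
open import Data.List.Relation.Unary.AllPairs using ([]; _∷_)
open import Data.List.Relation.Unary.Any as Any using (Any; here; there; any?)
open import Data.List.Relation.Unary.Any.Properties using (lookup-index)
open import Data.List.Relation.Unary.Linked as Linked using (Linked; []; [-]; _∷_)
open import Data.List.Relation.Unary.Unique.Propositional using (Unique)
import Data.List.Relation.Unary.Unique.Propositional.Properties as Unique
open import Data.Nat using (zero; suc; _+_; _^_; _≟_; _≤?_; _<?_; _⊔_; z≤n; s≤s; ⌊_/2⌋; ⌈_/2⌉; NonZero; >-nonZero; >-nonZero⁻¹)
open import Data.Nat.ListAction using (sum)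
open import Data.Nat.Properties hiding (_≟_; _≤?_; _<?_)
open import Data.Nat.Tactic.RingSolver using (solve-∀)
open import Data.Product using (∃; ∃₂; _,_; proj₁; proj₂; map₂)
open import Data.Product.Properties using (≡-dec)
open import Data.Sum as Sum using (_⊎_; inj₁; inj₂; [_,_]′)
open import Data.Vec as Vec using (Vec; []; _∷_)
import Data.Vec.Properties as Vec
open import Function using (_∘_; id)
open import Relation.Binary.Definitions using (tri<; tri≈; tri>) renaming (Decidable to Decidable₂)
open import Relation.Binary.PropositionalEquality as ≡ using (_≡_; _≢_; refl; cong; cong₂; subst; subst₂; setoid)
open import Relation.Nullary using (¬_; Dec; yes; no; contradiction)
open import Relation.Nullary.Decidable using (_×-dec_; _⊎-dec_; _→-dec_; ¬?; toWitness; map′)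
open import Relation.Unary using (Decidable)

private
  variable
    A B C : Set
    xs ys : List A

-- Lists

∈-∃↭ : {x : A} → x ∈ xs → ∃ λ ys → xs ↭ x ∷ ys
∈-∃↭ {x = x} x∈xs with ys , zs , refl ← ∈-∃++ x∈xs = ys ++ zs , shift x ys zs

Unique-++⁻ : (xs : List A) → Unique (xs ++ ys) → Unique xs × Unique ys × Disjoint xs ys
Unique-++⁻ []       u          = [] , u , λ ()
Unique-++⁻ (x ∷ xs) (x∉ ∷ u) with xs! , ys! , xs#ys ← Unique-++⁻ xs u =
  All.++⁻ˡ xs x∉ ∷ xs! , ys! , λ
    { (here refl , q) → All.lookup (All.++⁻ʳ xs x∉) q refl
    ; (there p , q)   → xs#ys (p , q)
    }

Unique-resp-↭ : xs ↭ ys → Unique xs → Unique ys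
Unique-resp-↭ p = Permₛ.Unique-resp-↭ (setoid _) (↭⇒↭ₛ p)

-- Pigeonhole: the head is deleted from `ys` up to permutation, and uniqueness keeps the tail of
-- `xs` inside what is left.
Unique-⊆⇒length≤ : Unique xs → xs ⊆ ys → length xs ≤ length ys
Unique-⊆⇒length≤ [] _ = z≤n
Unique-⊆⇒length≤ {xs = x ∷ xs} (x∉xs ∷ xs!) sub with zs , p ← ∈-∃↭ (sub (here refl)) =
  subst (suc (length xs) ≤_) (≡.sym (↭-length p)) (s≤s (Unique-⊆⇒length≤ xs! xs⊆zs))
  where
  xs⊆zs : xs ⊆ zs
  xs⊆zs y∈xs with ∈-resp-↭ p (sub (there y∈xs))
  ... | here y≡x = contradiction (≡.sym y≡x) (All.lookup x∉xs y∈xs)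
  ... | there y∈zs = y∈zs

Unique⇒lookup-injective : Unique xs → ∀ {i j} → lookup xs i ≡ lookup xs j → i ≡ j
Unique⇒lookup-injective (_ ∷ _)    {zero}  {zero}  _  = refl
Unique⇒lookup-injective (x∉ ∷ _)   {zero}  {suc j} eq = contradiction eq (All.lookup x∉ (∈-lookup j))
Unique⇒lookup-injective (x∉ ∷ _)   {suc i} {zero}  eq = contradiction (≡.sym eq) (All.lookup x∉ (∈-lookup i))
Unique⇒lookup-injective (_ ∷ xs!)  {suc i} {suc j} eq = cong suc (Unique⇒lookup-injective xs! eq)

Linked-lookup : {R : A → A → Set} → Linked R xs →
                ∀ {i j} → toℕ j ≡ suc (toℕ i) → R (lookup xs i) (lookup xs j)
Linked-lookup (r ∷ _)  {zero}  {suc zero} _ = r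
Linked-lookup (_ ∷ rs) {suc i} {suc j}    e = Linked-lookup rs (suc-injective e)

module _ {S : A → Set} (S? : Decidable S) where

  count : List A → ℕ
  count xs = length (filter S? xs)

  count-++ : ∀ xs ys → count (xs ++ ys) ≡ count xs + count ys
  count-++ xs ys = ≡.trans (cong length (filter-++ S? xs ys)) (length-++ (filter S? xs))

  count-all : All S xs → count xs ≡ length xs
  count-all = cong length ∘ filter-all S?

  count-↭ : xs ↭ ys → count xs ≡ count ys
  count-↭ = ↭-length ∘ filter-↭ S?

  count-∷-≤ : ∀ x xs → count (x ∷ xs) ≤ suc (count xs)
  count-∷-≤ x xs with S? x
  ... | yes _ = ≤-refl
  ... | no  _ = n≤1+n _

  count-∁ : ∀ xs → count xs + length (filter (¬? ∘ S?) xs) ≡ length xs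
  count-∁ [] = refl
  count-∁ (x ∷ xs) with ih ← count-∁ xs | S? x
  ... | yes _ = cong suc ih
  ... | no  _ = ≡.trans (+-suc _ _) (cong suc ih)

  -- Entries are consumed two at a time, each pair contributing at most one; a single last entry
  -- accounts for the rounding up.
  count-alternating : Linked (λ x y → ¬ (S x × S y)) xs → count xs ≤ ⌈ length xs /2⌉
  count-alternating []  = z≤n
  count-alternating [-] = length-filter S? (_ ∷ [])
  count-alternating {xs = x ∷ y ∷ xs} (¬ss ∷ l) with ih ← count-alternating (Linked.tail l) | S? x
  ... | yes sx with S? y
  ...   | yes sy = contradiction (sx , sy) ¬ss
  ...   | no  _  = s≤s ih
  count-alternating {xs = x ∷ y ∷ xs} (¬ss ∷ l) | no _ with S? y
  ...   | yes _  = s≤s ih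
  ...   | no  _  = m≤n⇒m≤1+n ih

-- Monochromatic paths

-- `path` is the stack, top first. `weight` is the length in the blue search and the larger of two
-- side counts in the red one.
record SearchState {A : Set} (R : A → A → Set) (weight : List A → ℕ) (k : ℕ) (vertices : List A) : Set where
  field
    unexplored path finished : List A
    partition-↭ : vertices ↭ unexplored ++ path ++ finished
    linked      : Linked R path
    separated   : ∀ {u d} → u ∈ unexplored → d ∈ finished → ¬ R u d
    weight≡     : weight finished ≡ k

-- Vertices leave the stack one at a time, so the weight of the finished set
-- grows in unit steps and the search can be stopped when it is exactly k.
module DepthFirstSearch
  {A : Set} {R : A → A → Set} (R? : Decidable₂ R)
  (weight : List A → ℕ) (weight-∷ : ∀ x xs → weight (x ∷ xs) ≤ suc (weight xs))
  (k : ℕ) (vertices : List A) (k≤weight : ∀ {xs} → vertices ↭ xs → k ≤ weight xs)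
  where

  -- Terminates lexicographically in `m` and `P`: a push lowers `m`, a pop keeps it and shortens the
  -- stack. The length `m` is carried along because the list remaining after a push is known only up
  -- to permutation.
  explore : ∀ m U P D → length U ≡ m → vertices ↭ U ++ P ++ D → Linked R P →
            (∀ {u d} → u ∈ U → d ∈ D → ¬ R u d) → weight D ≤ k →
            SearchState R weight k vertices
  explore m U P D |U|≡m perm linked sep w≤k with weight D ≟ k
  ... | yes w≡k = record
    { unexplored = U ; path = P ; finished = D ; partition-↭ = perm
    ; linked = linked ; separated = sep ; weight≡ = w≡k }
  -- All vertices are in `D`, so its weight has already reached `k`.
  explore m [] [] D |U|≡m perm linked sep w≤k | no w≢k =
    contradiction (≤-antisym w≤k (k≤weight perm)) w≢k
  explore (suc m) (u ∷ U) [] D |U|≡m perm linked sep w≤k | no w≢k =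
    explore m U (u ∷ []) D (suc-injective |U|≡m) (↭-trans perm (↭-sym (shift u U D)))
      [-] (sep ∘ there) w≤k
  explore m U (p ∷ P) D |U|≡m perm linked sep w≤k | no w≢k with any? (λ u → R? u p) U
  -- Popping `p` keeps the separation, as no unexplored vertex is related to it. The weight was
  -- below `k`, so it cannot jump past `k`.
  ... | no none = explore m U P (p ∷ D) |U|≡m
          (↭-trans perm (++⁺ˡ U (↭-sym (shift p P D)))) (Linked.tail linked)
          (λ { u∈U (here refl) r → none (lose u∈U r) ; u∈U (there d∈D) → sep u∈U d∈D })
          (≤-trans (weight-∷ p D) (≤∧≢⇒< w≤k w≢k))
  ... | yes some with u , u∈U , r ← find some with U′ , q ← ∈-∃↭ u∈U with m | ≡.trans (≡.sym (↭-length q)) |U|≡m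
  ... | suc m′ | e =
    explore m′ U′ (u ∷ p ∷ P) D (suc-injective e)
      (↭-trans perm (↭-trans (++⁺ʳ (p ∷ P ++ D) q) (↭-sym (shift u U′ (p ∷ P ++ D)))))
      (r ∷ linked) (sep ∘ ∈-resp-↭ (↭-sym q) ∘ there) w≤k

  search : weight [] ≡ 0 → SearchState R weight k vertices
  search w≡0 = explore (length vertices) vertices [] [] refl
    (↭-reflexive (≡.sym (++-identityʳ vertices))) [] (λ _ ()) (subst (_≤ k) (≡.sym w≡0) z≤n)

linked⇒MonoCopy : ∀ (G : Graph) (c : Colouring G) b {R : Fin (V G) → Fin (V G) → Set} →
                  (∀ {x y} → R x y → Adj G x y × col c x y ≡ b) →
                  ∀ {n xs} → Unique xs → Linked R xs → n ≤ length xs → MonoCopy (P n) G c b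
linked⇒MonoCopy G c b edge {n} {xs} xs! linked n≤ =
  φ , (λ eq → inject≤-injective n≤ n≤ _ _ (Unique⇒lookup-injective xs! eq)) , mono
  where
  φ : Fin n → Fin (V G)
  φ i = lookup xs (inject≤ i n≤)
  step : ∀ i j → toℕ j ≡ suc (toℕ i) → Adj G (φ i) (φ j) × col c (φ i) (φ j) ≡ b
  step i j e = edge (Linked-lookup linked
    (≡.trans (toℕ-inject≤ j n≤) (≡.trans e (cong suc (≡.sym (toℕ-inject≤ i n≤))))))
  mono : ∀ i j → PathAdj n i j → Adj G (φ i) (φ j) × col c (φ i) (φ j) ≡ b
  mono i j (inj₁ e) = step i j e
  mono i j (inj₂ e) with a , ce ← step j i e = Graph.sym G a , ≡.trans (col-sym c (φ i) (φ j)) ce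

-- Arrowing of paths by connecting graphs

Connecting : Graph → ℕ → Set
Connecting G n = ∀ {S T} → Unique S → Unique T → Disjoint S T → n ≤ length S → n ≤ length T →
                 ∃₂ λ x y → x ∈ S × y ∈ T × Adj G x y

module _ (G : Graph) (n : ℕ) (6n≤V : 6 * n ≤ V G) (connecting : Connecting G n) (c : Colouring G) where

  open DecMembership (_≟ᶠ_ {V G}) using (_∈?_)

  private
    Vertex : Set
    Vertex = Fin (V G)

    -- The blue search needs `k + (k + n) ≤ 6 * n`; the red one needs `n` vertices of a side to
    -- remain after removing `n` finished ones and `⌊ n /2⌋` on the path.
    k : ℕ
    k = n + n + ⌊ n /2⌋

    2k+n≤6n : k + (k + n) ≤ 6 * n
    2k+n≤6n = begin
      k + (k + n)                           ≡⟨ rearrange n ⌊ n /2⌋ ⟩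
      5 * n + (⌊ n /2⌋ + ⌊ n /2⌋)           ≤⟨ +-monoʳ-≤ (5 * n) (+-monoʳ-≤ ⌊ n /2⌋ (⌊n/2⌋≤⌈n/2⌉ n)) ⟩
      5 * n + (⌊ n /2⌋ + ⌈ n /2⌉)           ≡⟨ cong (5 * n +_) (⌊n/2⌋+⌈n/2⌉≡n n) ⟩
      5 * n + n                             ≡⟨ collect n ⟩
      6 * n                                 ∎
      where
      open ≤-Reasoning
      rearrange : ∀ n h → n + n + h + (n + n + h + n) ≡ 5 * n + (h + h)
      rearrange = solve-∀
      collect : ∀ n → 5 * n + n ≡ 6 * n
      collect = solve-∀

    Blue : Vertex → Vertex → Set
    Blue x y = Adj G x y × col c x y ≡ true

    Blue? : Decidable₂ Blue
    Blue? x y = adj? G x y ×-dec (col c x y Bool.≟ true)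

  -- The red search between two sets without blue edges

  module _ {U D : List Vertex} (U#D : Disjoint U D) (U++D! : Unique (U ++ D))
           (k≤U : k ≤ length U) (k≤D : k ≤ length D)
           (sep : ∀ {u d} → u ∈ U → d ∈ D → ¬ Blue u d) where

    private
      InU NotInU : Vertex → Set
      InU    = _∈ U
      NotInU x = ¬ x ∈ U

      InU? : Decidable InU
      InU? = _∈? U

      NotInU? : Decidable NotInU
      NotInU? x = ¬? (InU? x)

      -- Only edges changing sides are followed, so that every path alternates.
      CrossRed : Vertex → Vertex → Set
      CrossRed x y = (Adj G x y × col c x y ≡ false) × ((InU x × NotInU y) ⊎ (NotInU x × InU y))

      CrossRed? : Decidable₂ CrossRed
      CrossRed? x y = (adj? G x y ×-dec (col c x y Bool.≟ false))
        ×-dec ((InU? x ×-dec NotInU? y) ⊎-dec (NotInU? x ×-dec InU? y))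

      -- Stopping when the maximum is `n` gives `n` finished vertices on one side and at most `n` on
      -- the other.
      weight : List Vertex → ℕ
      weight xs = count InU? xs ⊔ count NotInU? xs

      weight-∷ : ∀ x xs → weight (x ∷ xs) ≤ suc (weight xs)
      weight-∷ x xs = ⊔-mono-≤ (count-∷-≤ InU? x xs) (count-∷-≤ NotInU? x xs)

      k≤InU : k ≤ count InU? (U ++ D)
      k≤InU = begin
        k                               ≤⟨ k≤U ⟩
        length U                        ≡⟨ count-all InU? (All.tabulate id) ⟨
        count InU? U                    ≤⟨ m≤m+n _ _ ⟩
        count InU? U + count InU? D     ≡⟨ count-++ InU? U D ⟨
        count InU? (U ++ D)             ∎
        where open ≤-Reasoning

      k≤NotInU : k ≤ count NotInU? (U ++ D)
      k≤NotInU = begin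
        k                                   ≤⟨ k≤D ⟩
        length D                            ≡⟨ count-all NotInU? (All.tabulate λ d∈D d∈U → U#D (d∈U , d∈D)) ⟨
        count NotInU? D                     ≤⟨ m≤n+m _ _ ⟩
        count NotInU? U + count NotInU? D   ≡⟨ count-++ NotInU? U D ⟨
        count NotInU? (U ++ D)              ∎
        where open ≤-Reasoning

      n≤k : n ≤ k
      n≤k = ≤-trans (m≤m+n n n) (m≤m+n (n + n) _)

      n≤weight : ∀ {xs} → U ++ D ↭ xs → n ≤ weight xs
      n≤weight p = ≤-trans n≤k (≤-trans k≤InU (≤-trans (≤-reflexive (count-↭ InU? p)) (m≤m⊔n _ _)))

      module _ (state : SearchState CrossRed weight n (U ++ D)) where

        open SearchState state renaming (unexplored to U′; path to P′; finished to D′)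

        all! : Unique (U′ ++ P′ ++ D′)
        all! = Unique-resp-↭ partition-↭ U++D!

        U′! : Unique U′
        U′! = proj₁ (Unique-++⁻ U′ all!)

        P′! : Unique P′
        P′! = proj₁ (Unique-++⁻ P′ (proj₁ (proj₂ (Unique-++⁻ U′ all!))))

        D′! : Unique D′
        D′! = proj₁ (proj₂ (Unique-++⁻ P′ (proj₁ (proj₂ (Unique-++⁻ U′ all!)))))

        ∉U⇒∈D : ∀ {x} → x ∈ U ++ D → NotInU x → x ∈ D
        ∉U⇒∈D x∈ x∉U with ∈-++⁻ U x∈
        ... | inj₁ x∈U = contradiction x∈U x∉U
        ... | inj₂ x∈D = x∈D

        U′⊆ : ∀ {x} → x ∈ U′ → x ∈ U ++ D
        U′⊆ x∈ = ∈-resp-↭ (↭-sym partition-↭) (∈-++⁺ˡ x∈)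

        D′⊆ : ∀ {x} → x ∈ D′ → x ∈ U ++ D
        D′⊆ x∈ = ∈-resp-↭ (↭-sym partition-↭) (∈-++⁺ʳ U′ (∈-++⁺ʳ P′ x∈))

        -- A red edge is excluded by the red search, a blue one by the separation of `U` and `D`.
        nonadjacent : ∀ {u d} → u ∈ U′ → d ∈ D′ → (InU u × NotInU d) ⊎ (NotInU u × InU d) → ¬ Adj G u d
        nonadjacent {u} {d} u∈U′ d∈D′ side adj with col c u d in ceq
        ... | false = separated u∈U′ d∈D′ ((adj , ceq) , side)
        nonadjacent {u} {d} u∈U′ d∈D′ (inj₁ (u∈U , d∉U)) adj | true =
          sep u∈U (∉U⇒∈D (D′⊆ d∈D′) d∉U) (adj , ceq)
        nonadjacent {u} {d} u∈U′ d∈D′ (inj₂ (u∉U , d∈U)) adj | true =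
          sep d∈U (∉U⇒∈D (U′⊆ u∈U′) u∉U) (Graph.sym G adj , ≡.trans (col-sym c d u) ceq)

        -- Of at least `k` vertices on a side, at most `n` are finished and at most `⌊ n /2⌋` lie on
        -- the alternating path.
        many-unexplored : length P′ < n → {S : Vertex → Set} (S? : Decidable S) →
          (∀ {x y} → CrossRed x y → ¬ (S x × S y)) →
          k ≤ count S? (U ++ D) → count S? D′ ≤ n → n ≤ count S? U′
        many-unexplored P′<n S? alternate k≤S D′≤n = +-cancelʳ-≤ (⌊ n /2⌋ + n) _ _ (begin
          n + (⌊ n /2⌋ + n)                                ≡⟨ swap n ⌊ n /2⌋ ⟩
          k                                                ≤⟨ k≤S ⟩
          count S? (U ++ D)                                ≡⟨ count-↭ S? partition-↭ ⟩
          count S? (U′ ++ P′ ++ D′)                        ≡⟨ count-++ S? U′ (P′ ++ D′) ⟩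
          count S? U′ + count S? (P′ ++ D′)                ≡⟨ cong (count S? U′ +_) (count-++ S? P′ D′) ⟩
          count S? U′ + (count S? P′ + count S? D′)        ≤⟨ +-monoʳ-≤ (count S? U′) (+-mono-≤ half D′≤n) ⟩
          count S? U′ + (⌊ n /2⌋ + n)                      ∎)
          where
          open ≤-Reasoning
          swap : ∀ n h → n + (h + n) ≡ n + n + h
          swap = solve-∀
          half : count S? P′ ≤ ⌊ n /2⌋
          -- `⌈ l /2⌉` is `⌊ suc l /2⌋`, and `suc l ≤ n` for the path length `l`; hence the bound is
          -- rounded down.
          half = ≤-trans (count-alternating S? (Linked.map alternate linked)) (⌊n/2⌋-mono P′<n)

        -- Otherwise `connecting` would join the unexplored vertices of one side to the finished
        -- ones of the other, against `nonadjacent`.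
        no-two-sides : ∀ {S T : Vertex → Set} (S? : Decidable S) (T? : Decidable T) →
          (∀ {x} → S x → T x → ⊥) →
          (∀ {u d} → S u → T d → (InU u × NotInU d) ⊎ (NotInU u × InU d)) →
          n ≤ count S? U′ → ¬ n ≤ count T? D′
        no-two-sides S? T? excl side n≤S n≤T
          with x , y , x∈ , y∈ , adj ← connecting (Unique.filter⁺ S? U′!) (Unique.filter⁺ T? D′!)
                 (λ (p , q) → excl (proj₂ (∈-filter⁻ S? {xs = U′} p)) (proj₂ (∈-filter⁻ T? {xs = D′} q))) n≤S n≤T
          with x∈U′ , sx ← ∈-filter⁻ S? x∈ | y∈D′ , ty ← ∈-filter⁻ T? {xs = D′} y∈ =
          nonadjacent x∈U′ y∈D′ (side sx ty) adj

        long-red-path : n ≤ length P′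
        long-red-path with n ≤? length P′
        ... | yes n≤ = n≤
        -- The side attaining the maximum supplies the finished vertices, the opposite side the
        -- unexplored ones.
        ... | no n≰ with ⊔-sel (count InU? D′) (count NotInU? D′)
        ... | inj₁ eq = contradiction (≤-reflexive (≡.trans (≡.sym weight≡) eq))
          (no-two-sides NotInU? InU? (λ p q → p q) (λ p q → inj₂ (p , q))
            (many-unexplored (≰⇒> n≰) NotInU? (λ { (_ , inj₁ (x∈ , _)) (x∉ , _) → x∉ x∈ ; (_ , inj₂ (_ , y∈)) (_ , y∉) → y∉ y∈ })
              k≤NotInU (≤-trans (m≤n⊔m _ _) (≤-reflexive weight≡))))
        ... | inj₂ eq = contradiction (≤-reflexive (≡.trans (≡.sym weight≡) eq))
          (no-two-sides InU? NotInU? (λ p q → q p) (λ p q → inj₁ (p , q))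
            (many-unexplored (≰⇒> n≰) InU? (λ { (_ , inj₁ (_ , y∉)) (_ , y∈) → y∉ y∈ ; (_ , inj₂ (x∉ , _)) (x∈ , _) → x∉ x∈ })
              k≤InU (≤-trans (m≤m⊔n _ _) (≤-reflexive weight≡))))

        red-path-copy : MonoCopy (P n) G c false
        red-path-copy = linked⇒MonoCopy G c false proj₁ P′! linked long-red-path

    red-copy : MonoCopy (P n) G c false
    red-copy = red-path-copy (DepthFirstSearch.search CrossRed? weight weight-∷ n (U ++ D) n≤weight refl)

  private
    k≤length : ∀ {xs} → allFin (V G) ↭ xs → k ≤ length xs
    k≤length p = ≤-trans (m≤m+n k (k + n)) (≤-trans 2k+n≤6n (≤-trans 6n≤V
        (≤-reflexive (≡.trans (≡.sym (length-tabulate id)) (↭-length p)))))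

    module _ (state : SearchState Blue length k (allFin (V G))) where

      open SearchState state renaming (unexplored to U; path to Q; finished to D)

      all! : Unique (U ++ Q ++ D)
      all! = Unique-resp-↭ partition-↭ (Unique.allFin⁺ (V G))

      Q++D! : Unique (Q ++ D)
      Q++D! = proj₁ (proj₂ (Unique-++⁻ U all!))

      U#D : Disjoint U D
      U#D (p , q) = proj₂ (proj₂ (Unique-++⁻ U all!)) (p , ∈-++⁺ʳ Q q)

      k≤U : length Q < n → k ≤ length U
      k≤U Q<n = +-cancelʳ-≤ (n + k) _ _ (begin
        k + (n + k)                       ≡⟨ cong (k +_) (+-comm n k) ⟩
        k + (k + n)                       ≤⟨ 2k+n≤6n ⟩
        6 * n                             ≤⟨ 6n≤V ⟩
        V G                               ≡⟨ length-tabulate id ⟨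
        length (allFin (V G))             ≡⟨ ↭-length partition-↭ ⟩
        length (U ++ Q ++ D)              ≡⟨ length-++ U ⟩
        length U + length (Q ++ D)        ≡⟨ cong (length U +_) (length-++ Q) ⟩
        length U + (length Q + length D)  ≤⟨ +-monoʳ-≤ (length U) (+-mono-≤ (<⇒≤ Q<n) (≤-reflexive weight≡)) ⟩
        length U + (n + k)                ∎)
        where open ≤-Reasoning

      state⇒MonoCopy : Σ Bool λ b → MonoCopy (P n) G c b
      state⇒MonoCopy with n ≤? length Q
      ... | yes n≤Q = true , linked⇒MonoCopy G c true id (proj₁ (Unique-++⁻ Q Q++D!)) linked n≤Q
      ... | no  n≰Q = false , red-copy U#D
        (Unique.++⁺ (proj₁ (Unique-++⁻ U all!)) (proj₁ (proj₂ (Unique-++⁻ Q Q++D!))) U#D)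
        (k≤U (≰⇒> n≰Q)) (≤-reflexive (≡.sym weight≡)) separated

  connecting⇒MonoCopy : Σ Bool λ b → MonoCopy (P n) G c b
  connecting⇒MonoCopy = state⇒MonoCopy
    (DepthFirstSearch.search Blue? length (λ _ _ → ≤-refl) k (allFin (V G)) k≤length refl)

-- Enumeration of words and bounds on sums

length-cartesianProductWith : (f : A → B → C) (xs : List A) (ys : List B) →
                              length (cartesianProductWith f xs ys) ≡ length xs * length ys
length-cartesianProductWith f []       ys = refl
length-cartesianProductWith f (x ∷ xs) ys = ≡.trans (length-++ (map (f x) ys))
  (cong₂ _+_ (length-map (f x) ys) (length-cartesianProductWith f xs ys))

-- The finite search space for vertex labellings, maps between graphs, colour matrices and coded
-- edge lists.
words : List A → (m : ℕ) → List (Vec A m)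
words xs zero    = [] ∷ []
words xs (suc m) = cartesianProductWith _∷_ xs (words xs m)

length-words : (xs : List A) (m : ℕ) → length (words xs m) ≡ length xs ^ m
length-words xs zero    = refl
length-words xs (suc m) = ≡.trans (length-cartesianProductWith _∷_ xs (words xs m))
  (cong (length xs *_) (length-words xs m))

∈-words : (∀ x → x ∈ xs) → ∀ {m} (v : Vec A m) → v ∈ words xs m
∈-words complete []      = here refl
∈-words complete (x ∷ v) = ∈-cartesianProductWith⁺ _∷_ (complete x) (∈-words complete v)

sum-map-≤ : (f : A → ℕ) {b : ℕ} → All (λ x → f x ≤ b) xs → sum (map f xs) ≤ length xs * b
sum-map-≤ f []         = z≤n
sum-map-≤ f (fx ∷ fxs) = +-mono-≤ fx (sum-map-≤ f fxs)

sum-map-≥ : (f : A → ℕ) {b : ℕ} → All (λ x → b ≤ f x) xs → length xs * b ≤ sum (map f xs)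
sum-map-≥ f []         = z≤n
sum-map-≥ f (fx ∷ fxs) = +-mono-≤ fx (sum-map-≥ f fxs)

sum-map-0 : (ys : List A) → sum (map (λ _ → 0) ys) ≡ 0
sum-map-0 []       = refl
sum-map-0 (_ ∷ ys) = sum-map-0 ys

-- Greedy choice of the edges

+-swap : ∀ a b c → a + (b + c) ≡ b + (a + c)
+-swap = solve-∀

*-swap : ∀ a b c → a * (b * c) ≡ b * (a * c)
*-swap = solve-∀

-- `E` will be the ordered pairs of vertices, `C` the words encoding pairs `(S, T)`, and `Hits` the
-- relation of joining.
module Greedy {E C : Set} {Hits : E → C → Set} (hits? : ∀ e v → Dec (Hits e v)) where

  hitters : C → List E → ℕ
  hitters v = count (λ e → hits? e v)

  sum-hitters-∷ : ∀ e es vs → sum (map (λ v → hitters v (e ∷ es)) vs) ≡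
                              count (hits? e) vs + sum (map (λ v → hitters v es) vs)
  sum-hitters-∷ e es [] = refl
  sum-hitters-∷ e es (v ∷ vs) with ih ← sum-hitters-∷ e es vs | hits? e v
  ... | yes _ = cong suc (≡.trans (cong (hitters v es +_) ih)
                  (+-swap (hitters v es) (count (hits? e) vs) _))
  ... | no  _ = ≡.trans (cong (hitters v es +_) ih)
                  (+-swap (hitters v es) (count (hits? e) vs) _)

  -- Both sides count the hitting pairs, grouped by either coordinate.
  double-counting : ∀ es vs → sum (map (λ e → count (hits? e) vs) es) ≡
                              sum (map (λ v → hitters v es) vs)
  double-counting []       vs = ≡.sym (sum-map-0 vs)
  double-counting (e ∷ es) vs = ≡.trans (cong (count (hits? e) vs +_) (double-counting es vs))
    (≡.sym (sum-hitters-∷ e es vs))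

  module _ (e₀ : E) (es : List E) (s t : ℕ) .{{_ : NonZero t}} (|es|≡ : length es ≡ suc s * t) where

    Popular : C → Set
    Popular v = t ≤ hitters v es

    -- Averaging: the hits number at least `length vs * t` in total, spread over `suc s * t`
    -- candidates, so a best candidate takes a share of at least `1/(suc s)`.
    hits-many : ∀ vs → All Popular vs → ∃ λ e → length vs ≤ suc s * count (hits? e) vs
    hits-many vs popular = e , *-cancelʳ-≤ _ _ t (begin
      length vs * t                                   ≤⟨ sum-map-≥ (λ v → hitters v es) popular ⟩
      sum (map (λ v → hitters v es) vs)               ≡⟨ double-counting es vs ⟨
      sum (map f es)                                  ≤⟨ sum-map-≤ f (f[xs]≤f[argmax] e₀ es) ⟩
      length es * f e                                 ≡⟨ cong (_* f e) |es|≡ ⟩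
      suc s * t * f e                                 ≡⟨ *-assoc (suc s) t (f e) ⟩
      suc s * (t * f e)                               ≡⟨ cong (suc s *_) (*-comm t (f e)) ⟩
      suc s * (f e * t)                               ≡⟨ *-assoc (suc s) (f e) t ⟨
      suc s * f e * t                                 ∎)
      where
      open ≤-Reasoning
      f : E → ℕ
      f e = count (hits? e) vs
      e : E
      -- `e₀` is only the start value; should it be returned, it still bounds all of `es`.
      e = argmax f e₀ es

    few-survive : ∀ e vs → length vs ≤ suc s * count (hits? e) vs →
                  suc s * count (¬? ∘ hits? e) vs ≤ s * length vs
    few-survive e vs h = +-cancelˡ-≤ (length vs) _ _ (begin
      length vs + suc s * survivors              ≤⟨ +-monoˡ-≤ (suc s * survivors) h ⟩
      suc s * count (hits? e) vs + suc s * survivors ≡⟨ *-distribˡ-+ (suc s) (count (hits? e) vs) survivors ⟨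
      suc s * (count (hits? e) vs + survivors)   ≡⟨ cong (suc s *_) (count-∁ (hits? e) vs) ⟩
      suc s * length vs                          ∎)
      where
      open ≤-Reasoning
      survivors : ℕ
      survivors = count (¬? ∘ hits? e) vs

    -- The greedy invariant with `j` choices left is `length vs * (s / suc s)^j < 1`, stated without
    -- fractions.
    survivors-small : ∀ j e vs → length vs ≤ suc s * count (hits? e) vs →
                      s ^ suc j * length vs < suc s ^ suc j →
                      s ^ j * count (¬? ∘ hits? e) vs < suc s ^ j
    survivors-small j e vs h small = *-cancelˡ-< (suc s) _ _ (begin-strict
      suc s * (s ^ j * count (¬? ∘ hits? e) vs)      ≡⟨ *-swap (suc s) (s ^ j) _ ⟩
      s ^ j * (suc s * count (¬? ∘ hits? e) vs)      ≤⟨ *-monoʳ-≤ (s ^ j) (few-survive e vs h) ⟩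
      s ^ j * (s * length vs)                        ≡⟨ *-swap (s ^ j) s (length vs) ⟩
      s * (s ^ j * length vs)                        ≡⟨ *-assoc s (s ^ j) (length vs) ⟨
      s * s ^ j * length vs                          <⟨ small ⟩
      suc s * suc s ^ j                              ∎)
      where open ≤-Reasoning

    hitting-list : ∀ j vs → All Popular vs → s ^ j * length vs < suc s ^ j →
                   ∃ λ ds → length ds ≡ j × (∀ {v} → v ∈ vs → Any (λ e → Hits e v) ds)
    -- With no choice left the invariant reads `length vs < 1`.
    hitting-list zero []      _       _ = [] , refl , λ ()
    hitting-list zero (_ ∷ _) _ (s≤s ())
    hitting-list (suc j) vs popular small
      with e , h ← hits-many vs popular
      with ds , |ds|≡j , hit ← hitting-list j (filter (¬? ∘ hits? e) vs)
             (All.filter⁺ (¬? ∘ hits? e) popular) (survivors-small j e vs h small)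
      = e ∷ ds , cong suc |ds|≡j , hit-all
      where
      hit-all : ∀ {v} → v ∈ vs → Any (λ e → Hits e v) (e ∷ ds)
      hit-all {v} v∈vs with hits? e v
      ... | yes ehv = here ehv
      ... | no ¬ehv = there (hit (∈-filter⁺ (¬? ∘ hits? e) v∈vs ¬ehv))

-- Graphs given by lists of vertex pairs

fromEdges : (N : ℕ) → List (Fin N × Fin N) → Graph
fromEdges N es = record
  { V      = N
  ; Adj    = λ x y → x ≢ y × ((x , y) ∈ es ⊎ (y , x) ∈ es)
  ; adj?   = λ x y → ¬? (x ≟ᶠ y) ×-dec (((x , y) ∈? es) ⊎-dec ((y , x) ∈? es))
  ; sym    = λ (x≢y , e) → x≢y ∘ ≡.sym , Sum.swap e
  ; irrefl = λ (x≢x , _) → x≢x refl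
  }
  where open DecMembership (≡-dec (_≟ᶠ_ {N}) (_≟ᶠ_ {N})) using (_∈?_)

pairs : (N : ℕ) → List (Fin N × Fin N)
pairs N = cartesianProduct (allFin N) (allFin N)

pairs! : ∀ N → Unique (pairs N)
pairs! N = Unique.cartesianProduct⁺ (Unique.allFin⁺ N) (Unique.allFin⁺ N)

∈-pairs : ∀ {N} (p : Fin N × Fin N) → p ∈ pairs N
∈-pairs (x , y) = ∈-cartesianProduct⁺ (∈-allFin x) (∈-allFin y)

length-allFin : ∀ N → length (allFin N) ≡ N
length-allFin N = length-tabulate id

IsEdge? : (G : Graph) → Decidable (λ p → toℕ (proj₁ p) < toℕ (proj₂ p) × Adj G (proj₁ p) (proj₂ p))
IsEdge? G p = (toℕ (proj₁ p) <? toℕ (proj₂ p)) ×-dec adj? G (proj₁ p) (proj₂ p)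

edges : (G : Graph) → List (Fin (V G) × Fin (V G))
edges G = filter (IsEdge? G) (pairs (V G))

-- Every edge is an entry of `es` up to orientation. Loops and repetitions in `es` make this an
-- inequality only.
numEdges-fromEdges : ∀ N es → numEdges (fromEdges N es) ≤ length es
numEdges-fromEdges N es = ≤-trans
  (Unique-⊆⇒length≤ (Unique.filter⁺ (IsEdge? G) (pairs! N)) (λ {p} → edges⊆ {p}))
  (≤-reflexive (length-map ascending es))
  where
  G : Graph
  G = fromEdges N es
  ascending : Fin N × Fin N → Fin N × Fin N
  ascending (x , y) with toℕ x <? toℕ y
  ... | yes _ = x , y
  ... | no  _ = y , x
  ascending-< : ∀ {x y} → toℕ x < toℕ y → ascending (x , y) ≡ (x , y)
  ascending-< {x} {y} x<y with toℕ x <? toℕ y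
  ... | yes _   = refl
  ... | no  x≮y = contradiction x<y x≮y
  ascending-> : ∀ {x y} → toℕ x < toℕ y → ascending (y , x) ≡ (x , y)
  ascending-> {x} {y} x<y with toℕ y <? toℕ x
  ... | yes y<x = contradiction y<x (<-asym x<y)
  ... | no  _   = refl
  edges⊆ : edges G ⊆ map ascending es
  edges⊆ p∈ with ∈-filter⁻ (IsEdge? G) {xs = pairs N} p∈
  ... | _ , x<y , _ , inj₁ e = subst (_∈ map ascending es) (ascending-< x<y) (∈-map⁺ ascending e)
  ... | _ , x<y , _ , inj₂ e = subst (_∈ map ascending es) (ascending-> x<y) (∈-map⁺ ascending e)

-- A word v over Fin 3 encodes the disjoint pair S = v⁻¹(0), T = v⁻¹(1).
module _ {N : ℕ} where

  class : Fin 3 → Vec (Fin 3) N → List (Fin N)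
  class a v = filter (λ x → Vec.lookup v x ≟ᶠ a) (allFin N)

  Joins : Fin N × Fin N → Vec (Fin 3) N → Set
  Joins (x , y) v = (Vec.lookup v x ≡ 0F × Vec.lookup v y ≡ 1F) ⊎
                    (Vec.lookup v x ≡ 1F × Vec.lookup v y ≡ 0F)

  joins? : ∀ e v → Dec (Joins e v)
  joins? (x , y) v = ((Vec.lookup v x ≟ᶠ 0F) ×-dec (Vec.lookup v y ≟ᶠ 1F)) ⊎-dec
                     ((Vec.lookup v x ≟ᶠ 1F) ×-dec (Vec.lookup v y ≟ᶠ 0F))

  ∈-class⁻ : ∀ a v {x} → x ∈ class a v → Vec.lookup v x ≡ a
  ∈-class⁻ a v x∈ = proj₂ (∈-filter⁻ (λ x → Vec.lookup v x ≟ᶠ a) {xs = allFin N} x∈)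

  ∈-class⁺ : ∀ a v {x} → Vec.lookup v x ≡ a → x ∈ class a v
  ∈-class⁺ a v eq = ∈-filter⁺ (λ x → Vec.lookup v x ≟ᶠ a) (∈-allFin _) eq

  class! : ∀ a v → Unique (class a v)
  class! a v = Unique.filter⁺ (λ x → Vec.lookup v x ≟ᶠ a) (Unique.allFin⁺ N)

  Large : ℕ → Vec (Fin 3) N → Set
  Large n v = n ≤ length (class 0F v) × n ≤ length (class 1F v)

  large? : ∀ n v → Dec (Large n v)
  large? n v = (n ≤? length (class 0F v)) ×-dec (n ≤? length (class 1F v))

  -- `S × T` and `T × S` both consist of joining pairs, and they are disjoint since their first
  -- coordinates carry different labels.
  many-joins : ∀ n v → Large n v → 2 * (n * n) ≤ count (λ e → joins? e v) (pairs N)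
  many-joins n v (n≤S , n≤T) = begin
    2 * (n * n)                                    ≡⟨ cong (n * n +_) (+-identityʳ (n * n)) ⟩
    n * n + n * n                                  ≤⟨ +-mono-≤ (*-mono-≤ n≤S n≤T) (*-mono-≤ n≤T n≤S) ⟩
    length S * length T + length T * length S      ≡⟨ cong₂ _+_ (length-cartesianProductWith _,_ S T) (length-cartesianProductWith _,_ T S) ⟨
    length (cartesianProduct S T) + length (cartesianProduct T S) ≡⟨ length-++ (cartesianProduct S T) ⟨
    length (cartesianProduct S T ++ cartesianProduct T S) ≤⟨ Unique-⊆⇒length≤ unique (λ {p} → sub {p}) ⟩
    count (λ e → joins? e v) (pairs N)             ∎
    where
    open ≤-Reasoning
    S T : List (Fin N)
    S = class 0F v
    T = class 1F v
    disjoint : Disjoint (cartesianProduct S T) (cartesianProduct T S)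
    disjoint {x , y} (p , q) with () ← ≡.trans (≡.sym (∈-class⁻ 0F v (proj₁ (∈-cartesianProduct⁻ S T p))))
                                               (∈-class⁻ 1F v (proj₁ (∈-cartesianProduct⁻ T S q)))
    unique : Unique (cartesianProduct S T ++ cartesianProduct T S)
    unique = Unique.++⁺ (Unique.cartesianProduct⁺ (class! 0F v) (class! 1F v))
                        (Unique.cartesianProduct⁺ (class! 1F v) (class! 0F v)) (λ {p} → disjoint {p})
    joins : ∀ {p} → p ∈ cartesianProduct S T ++ cartesianProduct T S → Joins p v
    joins {x , y} p∈ with ∈-++⁻ (cartesianProduct S T) p∈
    ... | inj₁ q with x∈ , y∈ ← ∈-cartesianProduct⁻ S T q = inj₁ (∈-class⁻ 0F v x∈ , ∈-class⁻ 1F v y∈)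
    ... | inj₂ q with x∈ , y∈ ← ∈-cartesianProduct⁻ T S q = inj₂ (∈-class⁻ 1F v x∈ , ∈-class⁻ 0F v y∈)
    sub : cartesianProduct S T ++ cartesianProduct T S ⊆ filter (λ e → joins? e v) (pairs N)
    sub {p} p∈ = ∈-filter⁺ (λ e → joins? e v) (∈-pairs p) (joins p∈)

  -- The word of a given pair, with `2F` outside both sets. The inclusions into the classes give
  -- `Large`; `lookup-0` and `lookup-1` bring a joining pair back to `S` and `T`.
  module Labelling {S T : List (Fin N)} (S#T : Disjoint S T) where
    open DecMembership (_≟ᶠ_ {N}) using (_∈?_)

    label : Fin N → Fin 3
    label x with x ∈? S | x ∈? T
    ... | yes _ | _     = 0F
    ... | no  _ | yes _ = 1F
    ... | no  _ | no  _ = 2F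

    labelling : Vec (Fin 3) N
    labelling = Vec.tabulate label

    label-S : ∀ {x} → x ∈ S → label x ≡ 0F
    label-S {x} x∈S with x ∈? S | x ∈? T
    ... | yes _  | _ = refl
    ... | no x∉S | _ = contradiction x∈S x∉S

    label-T : ∀ {x} → x ∈ T → label x ≡ 1F
    label-T {x} x∈T with x ∈? S | x ∈? T
    ... | yes x∈S | _      = contradiction (x∈S , x∈T) S#T
    ... | no _    | yes _  = refl
    ... | no _    | no x∉T = contradiction x∈T x∉T

    label-0 : ∀ {x} → label x ≡ 0F → x ∈ S
    label-0 {x} eq with x ∈? S | x ∈? T
    label-0 {x} _  | yes x∈S | _     = x∈S
    label-0 {x} () | no _    | yes _
    label-0 {x} () | no _    | no _

    label-1 : ∀ {x} → label x ≡ 1F → x ∈ T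
    label-1 {x} eq with x ∈? S | x ∈? T
    label-1 {x} () | yes _ | _
    label-1 {x} _  | no _  | yes x∈T = x∈T
    label-1 {x} () | no _  | no _

    lookup-labelling : ∀ x → Vec.lookup labelling x ≡ label x
    lookup-labelling = Vec.lookup∘tabulate label

    S⊆class : S ⊆ class 0F labelling
    S⊆class {x} x∈S = ∈-class⁺ 0F labelling (≡.trans (lookup-labelling x) (label-S x∈S))

    T⊆class : T ⊆ class 1F labelling
    T⊆class {x} x∈T = ∈-class⁺ 1F labelling (≡.trans (lookup-labelling x) (label-T x∈T))

    lookup-0 : ∀ {x} → Vec.lookup labelling x ≡ 0F → x ∈ S
    lookup-0 {x} eq = label-0 (≡.trans (≡.sym (lookup-labelling x)) eq)

    lookup-1 : ∀ {x} → Vec.lookup labelling x ≡ 1F → x ∈ T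
    lookup-1 {x} eq = label-1 (≡.trans (≡.sym (lookup-labelling x)) eq)

  joining⇒Connecting : ∀ n es → (∀ v → Large n v → Any (λ e → Joins e v) es) →
                       Connecting (fromEdges N es) n
  joining⇒Connecting n es joining {S} {T} S! T! S#T n≤S n≤T
    with find (let open Labelling S#T in
               joining labelling (≤-trans n≤S (Unique-⊆⇒length≤ S! S⊆class) ,
                                  ≤-trans n≤T (Unique-⊆⇒length≤ T! T⊆class)))
  -- Disjointness of `S` and `T` shows that the pair is not a loop, which `fromEdges` would discard.
  ... | (x , y) , e∈es , inj₁ (x0 , y1) =
    x , y , lookup-0 x0 , lookup-1 y1 , (λ { refl → S#T (lookup-0 x0 , lookup-1 y1) }) , inj₁ e∈es
    where open Labelling S#T
  ... | (x , y) , e∈es , inj₂ (x1 , y0) =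
    y , x , lookup-0 y0 , lookup-1 x1 , (λ { refl → S#T (lookup-0 y0 , lookup-1 x1) }) , inj₂ e∈es
    where open Labelling S#T

-- Existence of sparse connecting graphs

^-distribʳ-* : ∀ a b n → (a * b) ^ n ≡ a ^ n * b ^ n
^-distribʳ-* a b zero    = refl
^-distribʳ-* a b (suc n) = ≡.trans (cong (a * b *_) (^-distribʳ-* a b n)) (interchange a b (a ^ n) (b ^ n))
  where
  interchange : ∀ a b c d → a * b * (c * d) ≡ a * c * (b * d)
  interchange = solve-∀

-- Taking `n`-th powers lets one numerical inequality serve for every `n`.
^-scale-< : ∀ a b c p q n .{{_ : NonZero n}} → a ^ p * b ^ q < c ^ p →
            a ^ (p * n) * b ^ (q * n) < c ^ (p * n)
^-scale-< a b c p q n h = begin-strict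
  a ^ (p * n) * b ^ (q * n)   ≡⟨ cong₂ _*_ (^-*-assoc a p n) (^-*-assoc b q n) ⟨
  (a ^ p) ^ n * (b ^ q) ^ n   ≡⟨ ^-distribʳ-* (a ^ p) (b ^ q) n ⟨
  (a ^ p * b ^ q) ^ n         <⟨ ^-monoˡ-< n h ⟩
  (c ^ p) ^ n                 ≡⟨ ^-*-assoc c p n ⟩
  c ^ (p * n)                 ∎
  where open ≤-Reasoning

length-pairs : ∀ N → length (pairs N) ≡ N * N
length-pairs N = ≡.trans (length-cartesianProductWith _,_ (allFin N) (allFin N))
  (cong₂ _*_ (length-allFin N) (length-allFin N))

-- The greedy choice with all `N * N` ordered pairs as candidates; the large words are bounded
-- crudely by all `3 ^ N` words.
∃-connecting : ∀ s n N M .{{_ : NonZero (2 * (n * n))}} → Fin N → N * N ≡ suc s * (2 * (n * n)) →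
               s ^ M * 3 ^ N < suc s ^ M →
               ∃ λ es → length es ≡ M × Connecting (fromEdges N es) n
∃-connecting s n N M x₀ N²≡ small
  with es , |es|≡ , hit ← Greedy.hitting-list joins? (x₀ , x₀) (pairs N) s (2 * (n * n))
         (≡.trans (length-pairs N) N²≡) M (filter (large? n) (words (allFin 3) N))
         (All.tabulate λ {v} v∈ → many-joins n v (proj₂ (∈-filter⁻ (large? n) {xs = words (allFin 3) N} v∈)))
         (≤-<-trans (*-monoʳ-≤ (s ^ M) (≤-trans (length-filter (large? n) (words (allFin 3) N))
                      (≤-reflexive (length-words (allFin 3) N))))
           small)
  = es , |es|≡ , joining⇒Connecting n es (λ v large → hit (∈-filter⁺ (large? n) (∈-words ∈-allFin v) large))

abstract
  17^136*3^6<18^136 : 17 ^ 136 * 3 ^ 6 < 18 ^ 136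
  17^136*3^6<18^136 = toWitness {a? = 17 ^ 136 * 3 ^ 6 <? 18 ^ 136} _

-- Existence of the minimum

module _ (F G : Graph) where

  -- The condition of `MonoCopy` on one map, arranged so that quantification over `Fin` decides it.
  IsMonoCopy : (Fin (V G) → Fin (V G) → Bool) → Bool → (Fin (V F) → Fin (V G)) → Set
  IsMonoCopy κ b φ = (∀ i j → φ i ≡ φ j → i ≡ j) ×
                     (∀ i j → Adj F i j → Adj G (φ i) (φ j) × κ (φ i) (φ j) ≡ b)

  isMonoCopy? : ∀ κ b φ → Dec (IsMonoCopy κ b φ)
  isMonoCopy? κ b φ =
    Fin.all? (λ i → Fin.all? λ j → (φ i ≟ᶠ φ j) →-dec (i ≟ᶠ j)) ×-dec
    Fin.all? (λ i → Fin.all? λ j → adj? F i j →-dec (adj? G (φ i) (φ j) ×-dec (κ (φ i) (φ j) Bool.≟ b)))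

  -- Enumerated maps and colourings agree with given ones only pointwise, so copies must be
  -- transported along pointwise equality.
  IsMonoCopy-resp : ∀ {κ κ′ b φ φ′} → (∀ x y → κ x y ≡ κ′ x y) → (∀ i → φ i ≡ φ′ i) →
                    IsMonoCopy κ b φ → IsMonoCopy κ′ b φ′
  IsMonoCopy-resp {κ} {κ′} {b} {φ} {φ′} κ≗κ′ φ≗φ′ (inj , mono) =
    (λ i j eq → inj i j (≡.trans (φ≗φ′ i) (≡.trans eq (≡.sym (φ≗φ′ j))))) , mono′
    where
    mono′ : ∀ i j → Adj F i j → Adj G (φ′ i) (φ′ j) × κ′ (φ′ i) (φ′ j) ≡ b
    mono′ i j a with e , k ← mono i j a =
      subst₂ (Adj G) (φ≗φ′ i) (φ≗φ′ j) e ,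
      ≡.trans (≡.sym (κ≗κ′ (φ′ i) (φ′ j))) (≡.trans (≡.sym (cong₂ κ (φ≗φ′ i) (φ≗φ′ j))) k)

  MonoCopy-resp : ∀ {c c′ : Colouring G} {b} → (∀ x y → col c x y ≡ col c′ x y) →
                  MonoCopy F G c b → MonoCopy F G c′ b
  MonoCopy-resp {c} {c′} {b} c≗c′ (φ , inj , mono)
    with inj′ , mono′ ← IsMonoCopy-resp {col c} {col c′} {b} {φ} {φ} c≗c′ (λ _ → refl) ((λ _ _ → inj) , mono) =
    φ , inj′ _ _ , mono′

  monoCopy? : ∀ c b → Dec (MonoCopy F G c b)
  monoCopy? c b = map′ sound complete
    (any? (λ w → isMonoCopy? (col c) b (Vec.lookup w)) (words (allFin (V G)) (V F)))
    where
    sound : Any (λ w → IsMonoCopy (col c) b (Vec.lookup w)) (words (allFin (V G)) (V F)) → MonoCopy F G c b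
    sound some with w , _ , inj , mono ← find some = Vec.lookup w , inj _ _ , mono
    complete : MonoCopy F G c b → Any (λ w → IsMonoCopy (col c) b (Vec.lookup w)) (words (allFin (V G)) (V F))
    complete (φ , inj , mono) = lose (∈-words ∈-allFin (Vec.tabulate φ))
      (IsMonoCopy-resp {col c} (λ _ _ → refl) (λ i → ≡.sym (Vec.lookup∘tabulate φ i)) ((λ _ _ → inj) , mono))

  private
    Matrix : Set
    Matrix = Vec (Vec Bool (V G)) (V G)

    entry : Matrix → Fin (V G) → Fin (V G) → Bool
    entry m x y = Vec.lookup (Vec.lookup m x) y

    matrices : List Matrix
    matrices = words (words (true ∷ false ∷ []) (V G)) (V G)

    ∈-matrices : ∀ m → m ∈ matrices
    ∈-matrices = ∈-words (∈-words λ { true → here refl ; false → there (here refl) })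

    -- `∨` makes any matrix symmetric and, being idempotent, keeps symmetric ones; so enumerating
    -- all matrices reaches every colouring.
    symmetrise : Matrix → Colouring G
    symmetrise m = record
      { col     = λ x y → entry m x y ∨ entry m y x
      ; col-sym = λ x y → Bool.∨-comm (entry m x y) (entry m y x)
      }

    matrix : Colouring G → Matrix
    matrix c = Vec.tabulate λ x → Vec.tabulate (col c x)

    entry-matrix : ∀ c x y → entry (matrix c) x y ≡ col c x y
    entry-matrix c x y = ≡.trans (cong (λ r → Vec.lookup r y) (Vec.lookup∘tabulate _ x)) (Vec.lookup∘tabulate (col c x) y)

    symmetrise-matrix : ∀ c x y → col (symmetrise (matrix c)) x y ≡ col c x y
    symmetrise-matrix c x y = ≡.trans
      (cong₂ _∨_ (entry-matrix c x y) (≡.trans (entry-matrix c y x) (col-sym c y x))) (Bool.∨-idem (col c x y))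

    HasCopy : Matrix → Set
    HasCopy m = Σ Bool λ b → MonoCopy F G (symmetrise m) b

    hasCopy? : ∀ m → Dec (HasCopy m)
    hasCopy? m = map′ [ true ,_ , false ,_ ]′ (λ { (true , p) → inj₁ p ; (false , p) → inj₂ p })
      (monoCopy? (symmetrise m) true ⊎-dec monoCopy? (symmetrise m) false)

  arrow? : Dec (G ⟶ F)
  arrow? = map′ sound (λ arrow → All.tabulate λ {m} _ → arrow (symmetrise m)) (All.all? hasCopy? matrices)
    where
    sound : All HasCopy matrices → G ⟶ F
    sound all c with b , copy ← All.lookup all (∈-matrices (matrix c)) =
      b , MonoCopy-resp {symmetrise (matrix c)} {c} (symmetrise-matrix c) copy

-- Removal of isolated vertices

module _ (G : Graph) where

  adj⇒∈edges : ∀ {x y} → Adj G x y → (x , y) ∈ edges G ⊎ (y , x) ∈ edges G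
  adj⇒∈edges {x} {y} a with <-cmp (toℕ x) (toℕ y)
  ... | tri< x<y _ _ = inj₁ (∈-filter⁺ (IsEdge? G) (∈-pairs (x , y)) (x<y , a))
  ... | tri> _ _ y<x = inj₂ (∈-filter⁺ (IsEdge? G) (∈-pairs (y , x)) (y<x , Graph.sym G a))
  ... | tri≈ _ x≡y _ with refl ← toℕ-injective x≡y = contradiction a (Graph.irrefl G)

  endpoints : List (Fin (V G))
  endpoints = map proj₁ (edges G) ++ map proj₂ (edges G)

  length-endpoints : length endpoints ≡ numEdges G + numEdges G
  length-endpoints = ≡.trans (length-++ (map proj₁ (edges G)))
    (cong₂ _+_ (length-map proj₁ (edges G)) (length-map proj₂ (edges G)))

  adj⇒∈endpoints : ∀ {x y} → Adj G x y → x ∈ endpoints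
  adj⇒∈endpoints a with adj⇒∈edges a
  ... | inj₁ e = ∈-++⁺ˡ (∈-map⁺ proj₁ e)
  ... | inj₂ e = ∈-++⁺ʳ (map proj₁ (edges G)) (∈-map⁺ proj₂ e)

  module Compression (K : ℕ) (2e≤K : numEdges G + numEdges G ≤ suc K) where
    open DecMembership (_≟ᶠ_ {V G}) using (_∈?_)

    private
      bound : length endpoints ≤ suc K
      bound = ≤-trans (≤-reflexive length-endpoints) 2e≤K

    relabel : Fin (V G) → Fin (suc K)
    relabel x with x ∈? endpoints
    ... | yes x∈ = inject≤ (Any.index x∈) bound
    -- A default name for isolated vertices; `suc K` ensures that it exists even if `K` is 0.
    ... | no  _  = zero

    -- The new name of an endpoint is a position in `endpoints`, from which `lookup` recovers the
    -- vertex.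
    relabel-injective : ∀ {x y} → x ∈ endpoints → y ∈ endpoints → relabel x ≡ relabel y → x ≡ y
    relabel-injective {x} {y} x∈ y∈ eq with x ∈? endpoints | y ∈? endpoints
    ... | yes p | yes q = ≡.trans (lookup-index p) (≡.trans
            (cong (lookup endpoints) (inject≤-injective bound bound _ _ eq)) (≡.sym (lookup-index q)))
    ... | yes _ | no ¬q = contradiction y∈ ¬q
    ... | no ¬p | _     = contradiction x∈ ¬p

    relabel² : Fin (V G) × Fin (V G) → Fin (suc K) × Fin (suc K)
    relabel² (x , y) = relabel x , relabel y

    compressed : List (Fin (suc K) × Fin (suc K))
    compressed = map relabel² (edges G)

    length-compressed : length compressed ≡ numEdges G
    length-compressed = length-map relabel² (edges G)

    relabel-adj : ∀ {x y} → Adj G x y → Adj (fromEdges (suc K) compressed) (relabel x) (relabel y)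
    relabel-adj {x} {y} a = distinct , Sum.map (∈-map⁺ relabel²) (∈-map⁺ relabel²) (adj⇒∈edges a)
      where
      distinct : relabel x ≢ relabel y
      distinct eq with refl ← relabel-injective (adj⇒∈endpoints a) (adj⇒∈endpoints (Graph.sym G a)) eq =
        Graph.irrefl G a

    -- Isolated vertices are merged by relabel, so F must have none.
    compressed-⟶ : ∀ {F} → (∀ i → ∃ λ j → Adj F i j) → G ⟶ F → fromEdges (suc K) compressed ⟶ F
    compressed-⟶ {F} neighbour arrow c with arrow pullback
      where
      pullback : Colouring G
      pullback = record
        { col     = λ x y → col c (relabel x) (relabel y)
        ; col-sym = λ x y → col-sym c (relabel x) (relabel y)
        }
    ... | b , φ , inj , mono = b , relabel ∘ φ ,
      (λ {i} {j} eq → inj (relabel-injective (used i) (used j) eq)) ,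
      (λ i j a → relabel-adj (proj₁ (mono i j a)) , proj₂ (mono i j a))
      where
      used : ∀ i → φ i ∈ endpoints
      used i with j , a ← neighbour i = adj⇒∈endpoints (proj₁ (mono i j a))

least : {Q : ℕ → Set} → Decidable Q → ∀ m → Q m → ∃ λ r → r ≤ m × Q r × (∀ j → j < r → ¬ Q j)
least Q? zero    q = 0 , z≤n , q , λ _ ()
least Q? (suc m) q with Q? 0
... | yes q₀ = 0 , z≤n , q₀ , λ _ ()
... | no ¬q₀ with r , r≤m , qᵣ , min ← least (Q? ∘ suc) m q =
  suc r , s≤s r≤m , qᵣ , λ { zero _ → ¬q₀ ; (suc j) (s≤s j<r) → min j j<r }

-- Compression turns every arrowing graph with at most `M` edges into a list of equally many pairs
-- on one fixed vertex set, so the minimum can be sought among finitely many codes.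
sizeRamsey-exists : ∀ {F} → (∀ i → ∃ λ j → Adj F i j) → (G : Graph) → G ⟶ F →
                    Σ ℕ λ r → IsSizeRamsey F r × r ≤ numEdges G
sizeRamsey-exists {F} neighbour G G⟶F = conclude (least encodable? M (encode G ≤-refl G⟶F))
  where
  M K : ℕ
  M = numEdges G
  K = M + M

  Code : ℕ → Set
  Code m = Vec (Fin (suc K) × Fin (suc K)) m

  decode : ∀ {m} → Code m → Graph
  decode w = fromEdges (suc K) (Vec.toList w)

  Encodable : ℕ → Set
  Encodable m = Σ (Code m) λ w → decode w ⟶ F

  encodable? : Decidable Encodable
  encodable? m = map′ (λ some → let w , _ , arrow = find some in w , arrow)
    (λ (w , arrow) → lose (∈-words ∈-pairs w) arrow)
    (any? (λ w → arrow? F (decode w)) (words (pairs (suc K)) m))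

  encode : (H : Graph) → numEdges H ≤ M → H ⟶ F → Encodable (numEdges H)
  encode H e≤M H⟶F = subst Encodable length-compressed
    (Vec.fromList compressed , subst (λ es → fromEdges (suc K) es ⟶ F)
      (≡.sym (Vec.toList∘fromList compressed)) (compressed-⟶ {F} neighbour H⟶F))
    where open Compression H K (m≤n⇒m≤1+n (+-mono-≤ e≤M e≤M))

  conclude : (∃ λ r → r ≤ M × Encodable r × (∀ j → j < r → ¬ Encodable j)) →
             Σ ℕ λ r → IsSizeRamsey F r × r ≤ M
  conclude (r , r≤M , (w , arrow) , min) = r , ((decode w , arrow , exact) , minimal) , r≤M
    where
    minimal : (H : Graph) → H ⟶ F → r ≤ numEdges H
    minimal H H⟶F with r ≤? numEdges H
    ... | yes r≤ = r≤
    ... | no r≰  = contradiction (encode H (≤-trans (<⇒≤ (≰⇒> r≰)) r≤M) H⟶F) (min _ (≰⇒> r≰))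
    -- Loops or repetitions in the code could only lower the edge count, and minimality forbids
    -- that.
    exact : numEdges (decode w) ≡ r
    exact = ≤-antisym
      (≤-trans (numEdges-fromEdges (suc K) (Vec.toList w)) (≤-reflexive (Vec.length-toList w)))
      (minimal (decode w) arrow)

-- The bound for paths

path-neighbour : ∀ n → 2 ≤ n → ∀ i → ∃ λ j → Adj (P n) i j
path-neighbour (suc zero)    (s≤s ())
path-neighbour (suc (suc n)) _ zero    = suc zero , inj₁ refl
path-neighbour (suc (suc n)) _ (suc i) = inject₁ i , inj₂ (cong suc (≡.sym (Fin.toℕ-inject₁ i)))

scale-square : ∀ q n t → q * q ≡ t * 2 → (q * n) * (q * n) ≡ t * (2 * (n * n))
scale-square q n t q²≡ = ≡.trans (interchange q n) (≡.trans (cong (_* (n * n)) q²≡) (*-assoc t 2 (n * n)))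
  where
  interchange : ∀ q n → (q * n) * (q * n) ≡ q * q * (n * n)
  interchange = solve-∀

-- The graph has `q * n` vertices and comes from `p * n` greedy choices; `1/(suc s)` is the share of
-- joining pairs, `2 * (n * n)` out of `(q * n) * (q * n)`.
size-ramsey-path-≤ : ∀ s p q .{{_ : NonZero q}} → 6 ≤ q → q * q ≡ suc s * 2 →
                     s ^ p * 3 ^ q < suc s ^ p →
                     ∀ n → 2 ≤ n → Σ ℕ λ r → IsSizeRamsey (P n) r × r ≤ p * n
size-ramsey-path-≤ s p q 6≤q q²≡ small n 2≤n =
  conclude (∃-connecting s n (q * n) (p * n) x₀ (scale-square q n (suc s) q²≡)
    (^-scale-< s 3 (suc s) p q n small))
  where
  instance
    n≢0 : NonZero n
    n≢0 = >-nonZero (<⇒≤ 2≤n)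
    n²≢0 : NonZero (n * n)
    n²≢0 = m*n≢0 n n
    2n²≢0 : NonZero (2 * (n * n))
    2n²≢0 = m*n≢0 2 (n * n)
  x₀ : Fin (q * n)
  x₀ = fromℕ< {0} (>-nonZero⁻¹ (q * n) {{m*n≢0 q n}})
  conclude : (∃ λ es → length es ≡ p * n × Connecting (fromEdges (q * n) es) n) →
             Σ ℕ λ r → IsSizeRamsey (P n) r × r ≤ p * n
  conclude (es , |es|≡ , connecting) =
    map₂ (map₂ (λ r≤ → ≤-trans r≤ (≤-trans (numEdges-fromEdges (q * n) es) (≤-reflexive |es|≡))))
      (sizeRamsey-exists {P n} (path-neighbour n 2≤n) (fromEdges (q * n) es)
        (connecting⇒MonoCopy (fromEdges (q * n) es) n (*-monoˡ-≤ n 6≤q) connecting))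

theorem1p1 : Σ ℕ λ N → (n : ℕ) → N ≤ n → Σ ℕ λ r → IsSizeRamsey (P n) r × r < 137 * n
-- `137 * n` is `n + 136 * n`, and the spare `n ≥ 1` makes the bound strict. The share `1/18` comes
-- from `6 * 6 = 18 * 2`.
theorem1p1 = 2 , λ n 2≤n → map₂ (map₂ (λ r≤136n → +-mono-≤ (<⇒≤ 2≤n) r≤136n))
  (size-ramsey-path-≤ 17 136 6 ≤-refl refl 17^136*3^6<18^136 n 2≤n)
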